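{- For every connected graph $H$ with at least two vertices, every connected $H$-graph $G$ satisfies $\mathsf{lpt}(G) \le 4(\mathsf{tw}(H)+1)|E(H)|$.
   Context: All graphs are finite and simple. A subdivision $H'$ of $H$ is obtained by replacing each edge $xy$ of $H$ by a path from $x$ to $y$ of length at least one, with the interiors of these paths pairwise disjoint and anticomplete. A graph $G$ is an $H$-graph if there exist a subdivision $H^{\Phi}$ of $H$ and a map $\Phi: V(G)\to 2^{V(H^{\Phi})}$ such that each $H^{\Phi}[\Phi(v)]$ is connected and, for distinct $u,v\in V(G)$, $uv\in E(G)$ iff $\Phi(u)\cap\Phi(v)\neq\emptyset$. $\mathsf{tw}(H)$ is the treewidth of $H$. A longest path of a connected graph $G$ is a path of maximum length in $G$; a longest path transversal is a set of vertices meeting every longest path; $\mathsf{lpt}(G)$ is the minimum cardinality of a longest path transversal of $G$. -}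

module Defs where

open import Data.Empty using (⊥)
open import Data.Fin using (Fin; zero) renaming (_<_ to _<ᶠ_)
open import Data.Fin.Properties using () renaming (_<?_ to _<ᶠ?_)
open import Data.Fin.Subset using (Subset; _∈_; _∩_; ∣_∣; Nonempty; ⊤)
open import Data.Fin.Subset.Properties using (∈⊤)
open import Data.List using (List; []; _∷_; _++_; [_]; length; map; filter; allFin; cartesianProduct)
open import Data.List.Extrema.Nat using (max)
open import Data.List.Membership.Propositional using () renaming (_∈_ to _∈ˡ_)
open import Data.List.Relation.Unary.Any using (Any; here)
open import Data.List.Relation.Unary.Linked using (Linked)
open import Data.List.Relation.Unary.Unique.Propositional using (Unique)
open import Data.Nat using (ℕ; _≤_; _<_; _∸_)
open import Data.Nat.Induction using (<-rec)
open import Data.Nat.Properties using (≤-antisym; ≮⇒≥)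
open import Data.Product using (∃; ∃₂; ∃-syntax; _×_; _,_)
open import Data.Sum using (_⊎_)
open import Function.Bundles using (_⇔_)
open import Function.Definitions using (Injective)
open import Level using (0ℓ)
open import Relation.Binary.Construct.Closure.ReflexiveTransitive using (Star; ε)
open import Relation.Binary.Core using (Rel)
open import Relation.Binary.Definitions using (Decidable; Symmetric; Irreflexive)
open import Relation.Binary.PropositionalEquality using (_≡_; _≢_; refl)
open import Relation.Nullary using (¬_; no; contradiction)
open import Relation.Nullary.Decidable using (_×-dec_)
open import Relation.Unary using (Pred; U; Satisfiable)

record Graph : Set₁ where
  field
    order  : ℕ
    Adj    : Rel (Fin order) 0ℓ
    adj?   : Decidable Adj
    sym    : Symmetric Adj
    irrefl : Irreflexive _≡_ Adj

  V : Set
  V = Fin order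

  -- Each edge is listed once, with its smaller endpoint first.
  IsEdge : V → V → Set
  IsEdge x y = x <ᶠ y × Adj x y

  edges : List (V × V)
  edges = filter (λ (x , y) → (x <ᶠ? y) ×-dec adj? x y)
                 (cartesianProduct (allFin order) (allFin order))

  ∣E∣ : ℕ
  ∣E∣ = length edges

open Graph

-- The subgraph of G induced on P is connected (in particular, non-empty).
ConnectedOn : (G : Graph) → Pred (V G) 0ℓ → Set
ConnectedOn G P =
  Satisfiable P ×
  (∀ {u v} → P u → P v → Star (λ a b → P a × P b × Adj G a b) u v)

Connected : Graph → Set
Connected G = ConnectedOn G U

record IsPath (G : Graph) (p : List (V G)) : Set where
  field
    nonempty : p ≢ []
    linked   : Linked (Adj G) p
    distinct : Unique p

-- A cycle is a path on at least three vertices whose ends are adjacent.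
Acyclic : Graph → Set
Acyclic G = ∀ u w p v → IsPath G (u ∷ w ∷ p ++ [ v ]) → ¬ Adj G v u

IsTree : Graph → Set
IsTree G = Connected G × Acyclic G

Consecutive : {A : Set} → A → A → List A → Set
Consecutive u v p = ∃₂ λ as bs → p ≡ as ++ u ∷ v ∷ bs

-- S is a subdivision of H: `interior x y` lists, from x to y, the interior
-- vertices of the path replacing the edge xy; its value is irrelevant unless
-- `IsEdge H x y`.  An empty interior gives a path of length one.  By
-- `edge-cover` every edge of S lies on one of the paths, so distinct interiors
-- are anticomplete and no path has a chord.
record Subdivision (H S : Graph) : Set where
  field
    branch   : V H → V S
    branch-injective : Injective _≡_ _≡_ branch
    interior : V H → V H → List (V S)

  path : V H → V H → List (V S)
  path x y = branch x ∷ interior x y ++ [ branch y ]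

  field
    path-isPath : ∀ {x y} → IsEdge H x y → IsPath S (path x y)
    interior-not-branch : ∀ {x y v} → IsEdge H x y → v ∈ˡ interior x y →
                          ∀ z → v ≢ branch z
    interior-disjoint : ∀ {x y x′ y′ v} → IsEdge H x y → IsEdge H x′ y′ →
                        v ∈ˡ interior x y → v ∈ˡ interior x′ y′ →
                        (x , y) ≡ (x′ , y′)
    vertex-cover : ∀ v → (∃[ z ] v ≡ branch z) ⊎
                         (∃₂ λ x y → IsEdge H x y × v ∈ˡ interior x y)
    edge-cover : ∀ {u v} → Adj S u v →
                 ∃₂ λ x y → IsEdge H x y ×
                   (Consecutive u v (path x y) ⊎ Consecutive v u (path x y))

-- `H -Graph G`: G is an H-graph.
record _-Graph_ (H G : Graph) : Set₁ where
  field
    Hᶲ          : Graph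
    subdivision : Subdivision H Hᶲ
    Φ           : V G → Subset (order Hᶲ)
    Φ-connected : ∀ v → ConnectedOn Hᶲ (_∈ Φ v)
    Φ-adjacent  : ∀ {u v} → u ≢ v → Adj G u v ⇔ Nonempty (Φ u ∩ Φ v)

record TreeDecomposition (G : Graph) : Set₁ where
  field
    T          : Graph
    T-isTree   : IsTree T
    bag        : V T → Subset (order G)
    edge-cover : ∀ {u v} → Adj G u v → ∃[ t ] u ∈ bag t × v ∈ bag t
    -- Non-emptiness here says that every vertex lies in some bag.
    vertex-connected : ∀ v → ConnectedOn T (λ t → v ∈ bag t)

  -- Truncated subtraction matters only when G has no vertices.
  width : ℕ
  width = max 0 (map (λ t → ∣ bag t ∣) (allFin (order T))) ∸ 1

IsMinimum : ∀ {ℓ} → Pred ℕ ℓ → Pred ℕ ℓ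
IsMinimum P m = P m × (∀ {k} → P k → m ≤ k)

-- `Treewidth G w`: the treewidth of G is w.
Treewidth : Graph → ℕ → Set₁
Treewidth G = IsMinimum (λ w → ∃[ D ] TreeDecomposition.width {G} D ≡ w)

-- List length is one more than path length, so it orders paths the same way.
IsLongestPath : (G : Graph) → List (V G) → Set
IsLongestPath G p = IsPath G p × (∀ q → IsPath G q → length q ≤ length p)

IsLPTransversal : (G : Graph) → Subset (order G) → Set
IsLPTransversal G S = ∀ p → IsLongestPath G p → Any (_∈ S) p

-- `Lpt G k`: the minimum cardinality of a longest path transversal of G is k.
Lpt : Graph → ℕ → Set
Lpt G = IsMinimum (λ k → ∃[ S ] IsLPTransversal G S × ∣ S ∣ ≡ k)

-- The relations `Treewidth G` and `Lpt G` each hold of exactly one number;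
-- existence is stated classically.

IsMinimum-unique : ∀ {ℓ} {P : Pred ℕ ℓ} {m n} →
                   IsMinimum P m → IsMinimum P n → m ≡ n
IsMinimum-unique (pm , m≤) (pn , n≤) = ≤-antisym (m≤ pn) (n≤ pm)

IsMinimum-exists : ∀ {ℓ} {P : Pred ℕ ℓ} {n} → P n → ¬ ¬ ∃ (IsMinimum P)
IsMinimum-exists {P = P} {n} pn none = <-rec (λ k → ¬ P k) step n pn
  where
  step : ∀ k → (∀ {j} → j < k → ¬ P j) → ¬ P k
  step k below pk = none (k , pk , λ pj → ≮⇒≥ (λ j<k → below j<k pj))

Treewidth-exists : ∀ G → ¬ ¬ ∃ (Treewidth G)
Treewidth-exists G = IsMinimum-exists (oneBag , refl)
  where
  point : Graph
  point = record
    { order = 1 ; Adj = λ _ _ → ⊥ ; adj? = λ _ _ → no λ ()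
    ; sym = λ () ; irrefl = λ _ () }

  acyclic : Acyclic point
  acyclic u w p v isPath ()

  oneBag : TreeDecomposition G
  oneBag = record
    { T = point
    ; T-isTree = ((zero , _) , λ { {zero} {zero} _ _ → ε }) , acyclic
    ; bag = λ _ → ⊤
    ; edge-cover = λ _ → zero , ∈⊤ , ∈⊤
    ; vertex-connected = λ v → (zero , ∈⊤) , λ { {zero} {zero} _ _ → ε }
    }

Lpt-exists : ∀ G → ¬ ¬ ∃ (Lpt G)
Lpt-exists G = IsMinimum-exists (⊤ , all-meet , refl)
  where
  all-meet : IsLPTransversal G ⊤
  all-meet []      (isPath , _) = contradiction refl (IsPath.nonempty isPath)
  all-meet (_ ∷ _) _            = here ∈⊤

{-# OPTIONS --safe #-}

-- Two longest paths of a connected graph share a vertex, so their images in the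
-- subdivision S of H are pairwise intersecting connected sets.  Put the interior
-- of each edge xy of H into one bag containing x and y: these sets then trace
-- pairwise intersecting subtrees of an optimal tree decomposition of H, and by the
-- Helly property one bag t meets them all.
--
-- For a vertex b of S, the vertices v of G with b ∈ Φ v form a clique, and each
-- Φ v meets an edge path of S (if b is a branch vertex) in an initial and a final
-- segment.  Choosing for each edge and each direction a vertex of the clique
-- reaching furthest gives 2|E(H)| vertices: if a longest path used a clique vertex
-- v and no chosen one, then a chosen vertex adjacent to v and to its neighbour on
-- the path could be inserted between them.
--
-- If all longest paths meet the branch vertices in t, this yields at most
-- 2(tw(H)+1)|E(H)| vertices.  Otherwise some longest path lives inside an edge xy
-- with x, y in t; then every longest path contains x, contains y, or lives inside
-- xy too, and the latter share one vertex c, which costs two more vertices of G.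
-- The total 4|E(H)|+2 suffices because tw(H) ≥ 1.

module Submission where

open import Data.Empty using (⊥; ⊥-elim)
open import Data.Fin using (Fin; zero; suc)
open import Data.Fin.Properties using (_≟_) renaming (any? to anyFin?; <-cmp to <ᶠ-cmp; _<?_ to _<ᶠ?_)
open import Data.Fin.Subset using (Subset; ∣_∣; _∪_; ⁅_⁆; inside; outside) renaming (⊥ to ∅; _∈_ to _∈ˢ_; _∉_ to _∉ˢ_)
open import Data.Fin.Subset.Properties using (∣⊥∣≡0; ∪-identityˡ; x∈⁅x⁆; x∈p∪q⁺; x∈p∩q⁺; x∈p∩q⁻) renaming (_∈?_ to _∈ˢ?_)
open import Data.List using (List; []; _∷_; _++_; [_]; _∷ʳ_; length; map; allFin; reverse; _ʳ++_; initLast; _∷ʳ′_; filter; takeWhile)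
open import Data.List.Extrema.Nat using (argmax; argmax-all; f[xs]≤f[argmax]; max; xs≤max)
open import Data.List.Membership.DecPropositional using () renaming (_∈?_ to mem?)
open import Data.List.Membership.Propositional using (find) renaming (_∈_ to _∈ˡ_; _∉_ to _∉ˡ_; lose to loseˡ)
open import Data.List.Membership.Propositional.Properties using (∈-∃++; ∈-++⁺ʳ; ∈-++⁻; ∈-++⁺ˡ; ∈-insert; ∈-length; ∈-map⁺; ∈-allFin; ∈-filter⁺; ∈-cartesianProduct⁺)
open import Data.List.Properties using (++-assoc; ++-identityʳ; length-++; length-map; length-reverse; length-ʳ++; reverse-++; unfold-reverse; ∷-injective; ∷ʳ-injectiveʳ)
open import Data.List.Relation.Unary.All using (All; []; _∷_; all?) renaming (lookup to lookupᴬ; map to mapᴬ; tabulate to tabulateᴬ)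
open import Data.List.Relation.Unary.All.Properties using (++⁺; ++⁻ˡ; ++⁻ʳ; all-filter; ¬All⇒Any¬)
open import Data.List.Relation.Unary.AllPairs using ([]; _∷_)
open import Data.List.Relation.Unary.Any using (Any; here; there; any?) renaming (map to mapᴱ)
open import Data.List.Relation.Unary.Any.Properties using (reverse⁻)
open import Data.List.Relation.Unary.Linked using (Linked; []; [-]; _∷_)
open import Data.List.Relation.Unary.Unique.Propositional using (Unique)
open import Data.List.Relation.Unary.Unique.Propositional.Properties using (Unique[x∷xs]⇒x∉xs) renaming (++⁺ to Unique-++⁺)
open import Data.Nat using (ℕ; zero; suc; _+_; _*_; _∸_; _≤_; _<_; z≤n; s≤s)
open import Data.Nat.Induction using (<-rec)
open import Data.Nat.Properties using (≤-refl; ≤-trans; ≤-antisym; ≤-reflexive; ≤-total; <-cmp; <-irrefl; <⇒≤; <⇒≱; ≮⇒≥; _≤?_; n≤1+n; 1+n≰n; n≤0⇒n≡0; 0≢1+n; m≤m+n; m≤n+m; m≤n+m∸n; suc-injective; anyUpTo?; +-comm; +-suc; +-mono-≤; +-mono-<; +-monoʳ-≤; +-monoˡ-≤; *-monoˡ-≤; *-monoʳ-≤; ∸-cancelʳ-≤; module ≤-Reasoning)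
open import Data.Nat.Tactic.RingSolver using (solve-∀)
open import Data.Product using (∃; ∃₂; ∃-syntax; _×_; _,_; proj₁; proj₂)
open import Data.Sum using (_⊎_; inj₁; inj₂; [_,_]′)
open import Data.Vec using ([]; _∷_; here; there)
open import Function using (_∘_; id)
open import Function.Bundles using (Equivalence)
open import Level using (0ℓ)
open import Relation.Binary.Construct.Closure.ReflexiveTransitive using (Star; ε; _◅_; _◅◅_) renaming (gmap to mapStar; reverse to reverseStar)
open import Relation.Binary.Core using (Rel)
open import Relation.Binary.Definitions using (Symmetric; tri<; tri≈; tri>)
open import Relation.Binary.PropositionalEquality using (_≡_; _≢_; refl; sym; trans; cong; cong₂; subst)
open import Relation.Nullary using (¬_; Dec; yes; no; contradiction)
open import Relation.Nullary.Decidable using (_×-dec_; ¬?; decidable-stable; ¬¬-excluded-middle)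
open import Relation.Unary using (Pred; Decidable)
open import Defs

-- Lists without repetition and linked lists

module _ {A : Set} where

  Unique-ʳ++ : {xs ys : List A} → Unique xs → Unique ys →
               (∀ {z} → z ∈ˡ xs → z ∉ˡ ys) → Unique (xs ʳ++ ys)
  Unique-ʳ++ [] uy disj = uy
  Unique-ʳ++ {x ∷ xs} (px ∷ ux) uy disj =
    Unique-ʳ++ ux (tabulateᴬ (λ z∈ eq → disj (here refl) (subst (_∈ˡ _) (sym eq) z∈)) ∷ uy)
      λ { z∈ (here refl) → lookupᴬ px z∈ refl ; z∈ (there z∈ys) → disj (there z∈) z∈ys }

  Unique-++⁻ˡ : ∀ (xs : List A) {ys} → Unique (xs ++ ys) → Unique xs
  Unique-++⁻ˡ [] u = []
  Unique-++⁻ˡ (x ∷ xs) (px ∷ u) = ++⁻ˡ xs px ∷ Unique-++⁻ˡ xs u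

  Unique-++⁻ʳ : ∀ (xs : List A) {ys} → Unique (xs ++ ys) → Unique ys
  Unique-++⁻ʳ [] u = u
  Unique-++⁻ʳ (x ∷ xs) (px ∷ u) = Unique-++⁻ʳ xs u

  Unique-∉ : ∀ {x : A} {xs} → x ∉ˡ xs → Unique xs → Unique (x ∷ xs)
  Unique-∉ x∉ u = tabulateᴬ (λ z∈ eq → x∉ (subst (_∈ˡ _) (sym eq) z∈)) ∷ u

  Unique-insert : ∀ (xs : List A) {x ys} → x ∉ˡ xs ++ ys → Unique (xs ++ ys) → Unique (xs ++ x ∷ ys)
  Unique-insert [] x∉ u = Unique-∉ x∉ u
  Unique-insert (z ∷ xs) {x} x∉ (pz ∷ u) =
    ++⁺ (++⁻ˡ xs pz) ((λ eq → x∉ (here (sym eq))) ∷ ++⁻ʳ xs pz) ∷ Unique-insert xs (x∉ ∘ there) u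

  module _ {R : Rel A 0ℓ} where

    Linked-++⁻ˡ : ∀ xs {ys} → Linked R (xs ++ ys) → Linked R xs
    Linked-++⁻ˡ [] l = []
    Linked-++⁻ˡ (x ∷ []) l = [-]
    Linked-++⁻ˡ (x ∷ y ∷ xs) (r ∷ l) = r ∷ Linked-++⁻ˡ (y ∷ xs) l

    Linked-++⁻ʳ : ∀ xs {ys} → Linked R (xs ++ ys) → Linked R ys
    Linked-++⁻ʳ [] l = l
    Linked-++⁻ʳ (x ∷ []) [-] = []
    Linked-++⁻ʳ (x ∷ []) (r ∷ l) = l
    Linked-++⁻ʳ (x ∷ y ∷ xs) (r ∷ l) = Linked-++⁻ʳ (y ∷ xs) l

    Linked-insert : ∀ xs {u x v ys} → R u x → R x v →
                    Linked R (xs ++ u ∷ v ∷ ys) → Linked R (xs ++ u ∷ x ∷ v ∷ ys)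
    Linked-insert [] ux xv (_ ∷ l) = ux ∷ xv ∷ l
    Linked-insert (z ∷ []) ux xv (r ∷ _ ∷ l) = r ∷ ux ∷ xv ∷ l
    Linked-insert (z ∷ z′ ∷ xs) ux xv (r ∷ l) = r ∷ Linked-insert (z′ ∷ xs) ux xv l

    Linked-consecutive : ∀ xs {u v ys} → Linked R (xs ++ u ∷ v ∷ ys) → R u v
    Linked-consecutive xs l with Linked-++⁻ʳ xs l
    ... | r ∷ _ = r

    Linked-ʳ++ : Symmetric R → ∀ {x xs y ys} → R x y → Linked R (x ∷ xs) →
                 Linked R (y ∷ ys) → Linked R ((x ∷ xs) ʳ++ (y ∷ ys))
    Linked-ʳ++ sy {xs = []} r l ly = r ∷ ly
    Linked-ʳ++ sy {xs = z ∷ xs} r (rz ∷ l) ly = Linked-ʳ++ sy (sy rz) l (r ∷ ly)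

    Linked-reverse : Symmetric R → ∀ {xs} → Linked R xs → Linked R (reverse xs)
    Linked-reverse sy [] = []
    Linked-reverse sy [-] = [-]
    Linked-reverse sy (r ∷ l) = Linked-ʳ++ sy (sy r) l [-]

-- Longest paths of a connected graph

double : ∀ n → suc (n + suc n) ≡ 2 * suc n
double = solve-∀

module _ (G : Graph) where
  open Graph G using (V; Adj) renaming (sym to Adj-sym)

  Simple : List V → Set
  Simple p = Linked Adj p × Unique p

  longest-≥ : ∀ {p} → IsLongestPath G p → ∀ {x q} → Simple (x ∷ q) → length (x ∷ q) ≤ length p
  longest-≥ (_ , max) (l , u) = max _ (record { nonempty = λ () ; linked = l ; distinct = u })

  -- The longer side of `w` in `p` is kept together with `w`. Counting `w` on both sides makes the
  -- bound strict; a left side is reversed so as to start in `w`.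
  half : ∀ {p w} → Simple p → w ∈ˡ p →
         ∃[ h ] Simple (w ∷ h) × (∀ {z} → z ∈ˡ w ∷ h → z ∈ˡ p) × length p < 2 * length (w ∷ h)
  half {p} {w} (l , u) w∈ with ∈-∃++ w∈
  ... | as , bs , refl with ≤-total (length as) (length bs)
  ... | inj₁ a≤b = bs , (Linked-++⁻ʳ as l , Unique-++⁻ʳ as u) , ∈-++⁺ʳ as , bound
    where
    open ≤-Reasoning
    bound : length (as ++ w ∷ bs) < 2 * length (w ∷ bs)
    bound = begin-strict
      length (as ++ w ∷ bs)           ≡⟨ length-++ as ⟩
      length as + suc (length bs)     ≤⟨ +-monoˡ-≤ _ a≤b ⟩
      length bs + suc (length bs)     <⟨ ≤-reflexive (double (length bs)) ⟩
      2 * length (w ∷ bs)             ∎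
  ... | inj₂ b≤a = reverse as , subst Simple eq (Linked-reverse Adj-sym l′ , Unique-ʳ++ u′ [] λ _ ())
                 , back , bound
    where
    open ≤-Reasoning
    assoc : as ++ w ∷ bs ≡ (as ++ [ w ]) ++ bs
    assoc = sym (++-assoc as [ w ] bs)
    l′ : Linked Adj (as ++ [ w ])
    l′ = Linked-++⁻ˡ (as ++ [ w ]) (subst (Linked Adj) assoc l)
    u′ : Unique (as ++ [ w ])
    u′ = Unique-++⁻ˡ (as ++ [ w ]) (subst Unique assoc u)
    eq : reverse (as ++ [ w ]) ≡ w ∷ reverse as
    eq = reverse-++ as [ w ]
    back : ∀ {z} → z ∈ˡ w ∷ reverse as → z ∈ˡ as ++ w ∷ bs
    back {z} z∈ = subst (z ∈ˡ_) (sym assoc) (∈-++⁺ˡ {xs = as ++ [ w ]} (reverse⁻ (subst (z ∈ˡ_) (sym eq) z∈)))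
    bound : length (as ++ w ∷ bs) < 2 * length (w ∷ reverse as)
    bound = begin-strict
      length (as ++ w ∷ bs)           ≡⟨ length-++ as ⟩
      length as + suc (length bs)     ≤⟨ +-monoʳ-≤ (length as) (s≤s b≤a) ⟩
      length as + suc (length as)     <⟨ ≤-reflexive (double (length as)) ⟩
      2 * suc (length as)             ≡⟨ cong (λ n → 2 * suc n) (sym (length-reverse as)) ⟩
      2 * length (w ∷ reverse as)     ∎

  -- If P and Q were disjoint, follow a walk from P to Q and keep a path ending at
  -- the current vertex which is at least half of P followed by a stretch outside
  -- P ∪ Q.  On reaching Q, append the larger half of Q.
  module _ {P Q : List V} (longP : IsLongestPath G P) (longQ : IsLongestPath G Q)
           (disj : ∀ {z} → z ∈ˡ P → z ∉ˡ Q) where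

    simpleP : Simple P
    simpleP = IsPath.linked (proj₁ longP) , IsPath.distinct (proj₁ longP)

    simpleQ : Simple Q
    simpleQ = IsPath.linked (proj₁ longQ) , IsPath.distinct (proj₁ longQ)

    -- The path is listed backwards from the current vertex. When `outer` is empty, `w` is the head
    -- of `inner`; `starts` covers both cases.
    record Arm (w : V) : Set where
      field
        outer inner rest : List V
        simple    : Simple (outer ++ inner)
        starts    : outer ++ inner ≡ w ∷ rest
        inner⊆P   : ∀ {z} → z ∈ˡ inner → z ∈ˡ P
        outer∉P   : ∀ {z} → z ∈ˡ outer → z ∉ˡ P
        outer∉Q   : ∀ {z} → z ∈ˡ outer → z ∉ˡ Q
        long      : length P < 2 * length inner

      avoidsQ : ∀ {z} → z ∈ˡ outer ++ inner → z ∉ˡ Q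
      avoidsQ z∈ with ∈-++⁻ outer z∈
      ... | inj₁ z∈o = outer∉Q z∈o
      ... | inj₂ z∈i = disj (inner⊆P z∈i)

    half-arm : ∀ {w} → w ∈ˡ P → Arm w
    half-arm w∈ with half simpleP w∈
    ... | h , s , ⊆P , long = record
      { outer = [] ; inner = _ ∷ h ; rest = h ; simple = s ; starts = refl
      ; inner⊆P = ⊆P ; outer∉P = λ () ; outer∉Q = λ () ; long = long }

    -- A walk may revisit `outer`; the arm is then cut back to that vertex. Only `outer` ever
    -- changes, so `long` survives.
    extend-arm : ∀ {w w′} → Adj w w′ → w′ ∉ˡ P → w′ ∉ˡ Q → Arm w → Arm w′
    extend-arm {w} {w′} a w′∉P w′∉Q arm with mem? _≟_ w′ (Arm.outer arm)
    ... | yes w′∈ with ∈-∃++ w′∈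
    ... | as , bs , refl = record
      { outer = w′ ∷ bs ; inner = inner ; rest = bs ++ inner
      ; simple = Linked-++⁻ʳ as (subst (Linked Adj) assoc (proj₁ simple))
               , Unique-++⁻ʳ as (subst Unique assoc (proj₂ simple))
      ; starts = refl ; inner⊆P = inner⊆P
      ; outer∉P = outer∉P ∘ ∈-++⁺ʳ as ; outer∉Q = outer∉Q ∘ ∈-++⁺ʳ as ; long = long }
      where
      open Arm arm
      assoc : (as ++ w′ ∷ bs) ++ inner ≡ as ++ (w′ ∷ bs ++ inner)
      assoc = ++-assoc as (w′ ∷ bs) inner
    extend-arm {w} {w′} a w′∉P w′∉Q arm | no w′∉ = record
      { outer = w′ ∷ outer ; inner = inner ; rest = outer ++ inner
      ; simple = subst (Linked Adj ∘ (w′ ∷_)) (sym starts)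
                   (Adj-sym a ∷ subst (Linked Adj) starts (proj₁ simple))
               , Unique-∉ ([ w′∉ , w′∉P ∘ inner⊆P ]′ ∘ ∈-++⁻ outer) (proj₂ simple)
      ; starts = refl ; inner⊆P = inner⊆P
      ; outer∉P = λ { (here refl) → w′∉P ; (there z∈) → outer∉P z∈ }
      ; outer∉Q = λ { (here refl) → w′∉Q ; (there z∈) → outer∉Q z∈ }
      ; long = long }
      where open Arm arm

    -- `inner` is more than half of `P` and `h` with `w′` more than half of `Q`, so twice the joined
    -- path exceeds the lengths of `P` and `Q` together, although neither of them is shorter than
    -- it.
    arm-avoids-Q : ∀ {w w′} → Adj w w′ → w′ ∈ˡ Q → Arm w → ⊥
    arm-avoids-Q {w} {w′} a w′∈Q arm with half simpleQ w′∈Q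
    ... | h , (lh , uh) , ⊆Q , longh = <⇒≱ (+-mono-< (Arm.long arm) longh) (begin
        2 * length inner + 2 * length (w′ ∷ h)    ≡⟨ arith (length inner) (length (w′ ∷ h)) ⟩
        (length inner + length (w′ ∷ h)) + (length inner + length (w′ ∷ h)) ≤⟨ +-mono-≤ size size ⟩
        length joined + length joined             ≤⟨ +-mono-≤ (bound longP) (bound longQ) ⟩
        length P + length Q                       ∎)
      where
      open Arm arm
      open ≤-Reasoning
      arith : ∀ m n → 2 * m + 2 * n ≡ (m + n) + (m + n)
      arith = solve-∀
      joined : List V
      joined = (w ∷ rest) ʳ++ (w′ ∷ h)
      joined-simple : Simple joined
      joined-simple = Linked-ʳ++ Adj-sym a (subst (Linked Adj) starts (proj₁ simple)) lh
                    , Unique-ʳ++ (subst Unique starts (proj₂ simple)) uh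
                        (λ z∈ z∈h → avoidsQ (subst (_ ∈ˡ_) (sym starts) z∈) (⊆Q z∈h))
      bound : ∀ {R} → IsLongestPath G R → length joined ≤ length R
      bound longR with joined | joined-simple
      ... | []    | _ = z≤n
      ... | _ ∷ _ | s = longest-≥ longR s
      size : length inner + length (w′ ∷ h) ≤ length joined
      size = begin
        length inner + length (w′ ∷ h)                   ≤⟨ +-monoˡ-≤ _ (m≤n+m _ (length outer)) ⟩
        (length outer + length inner) + length (w′ ∷ h)  ≡⟨ cong (_+ _) (sym (length-++ outer)) ⟩
        length (outer ++ inner) + length (w′ ∷ h)        ≡⟨ cong (λ l → length l + length (w′ ∷ h)) starts ⟩
        length (w ∷ rest) + length (w′ ∷ h)              ≡⟨ sym (length-ʳ++ (w ∷ rest)) ⟩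
        length joined                                    ∎

    no-walk : ∀ {w q} {C : V → Set} → Star (λ a b → C a × C b × Adj a b) w q → q ∈ˡ Q → Arm w → ⊥
    no-walk ε q∈ arm = Arm.avoidsQ arm (subst (_ ∈ˡ_) (sym (Arm.starts arm)) (here refl)) q∈
    no-walk (_◅_ {j = w′} (_ , _ , a) walk) q∈ arm with mem? _≟_ w′ Q | mem? _≟_ w′ P
    ... | yes w′∈Q | _        = arm-avoids-Q a w′∈Q arm
    -- Back on `P`, the arm is dropped and a fresh half of `P` taken.
    ... | no _     | yes w′∈P = no-walk walk q∈ (half-arm w′∈P)
    ... | no w′∉Q  | no w′∉P  = no-walk walk q∈ (extend-arm a w′∉P w′∉Q arm)

  longest-paths-meet : Connected G → ∀ {P Q} → IsLongestPath G P → IsLongestPath G Q →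
                       ∃[ z ] z ∈ˡ P × z ∈ˡ Q
  longest-paths-meet conn {[]} longP longQ = contradiction refl (IsPath.nonempty (proj₁ longP))
  longest-paths-meet conn {_ ∷ _} {[]} longP longQ = contradiction refl (IsPath.nonempty (proj₁ longQ))
  longest-paths-meet conn {p ∷ P} {q ∷ Q} longP longQ with any? (λ z → mem? _≟_ z (q ∷ Q)) (p ∷ P)
  ... | yes common = find common
  ... | no none = contradiction (half-arm longP longQ disj (here refl))
                    (no-walk longP longQ disj (proj₂ conn _ _) (here refl))
    where
    disj : ∀ {z} → z ∈ˡ p ∷ P → z ∉ˡ q ∷ Q
    disj z∈P z∈Q = none (loseˡ z∈P z∈Q)

  longest-no-insertion : ∀ {P u v} → IsLongestPath G P → Consecutive u v P →
                         ∀ {x} → x ∉ˡ P → Adj u x → ¬ Adj x v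
  longest-no-insertion {u = u} {v} longP (as , bs , refl) {x} x∉ ux xv =
    <⇒≱ longer (longest (as ++ u ∷ x ∷ v ∷ bs) (record
      { nonempty = nonempty as
      ; linked = Linked-insert as ux xv (IsPath.linked (proj₁ longP))
      ; distinct = subst Unique (++-assoc as _ _) (Unique-insert (as ++ [ u ])
          (x∉ ∘ subst (x ∈ˡ_) (++-assoc as _ _)) (subst Unique (sym (++-assoc as _ _)) (IsPath.distinct (proj₁ longP)))) }))
    where
    longest = proj₂ longP
    nonempty : ∀ as → as ++ u ∷ x ∷ v ∷ bs ≢ []
    nonempty [] ()
    nonempty (_ ∷ _) ()
    longer : length (as ++ u ∷ v ∷ bs) < length (as ++ u ∷ x ∷ v ∷ bs)
    longer = ≤-reflexive (trans (cong suc (length-++ as)) (sym (trans (length-++ as) (+-suc _ _))))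

-- Subtrees of a tree

-- Decidability gives the minimum without double negation, so that `depth` below can be a function.
least : ∀ {P : Pred ℕ 0ℓ} → Decidable P → ∀ n → P n → ∃ (IsMinimum P)
least {P} P? = <-rec _ search
  where
  search : ∀ n → (∀ {m} → m < n → P m → ∃ (IsMinimum P)) → P n → ∃ (IsMinimum P)
  search n rec pn with anyUpTo? P? n
  ... | yes (m , m<n , pm) = rec m<n pm
  ... | no none = n , pn , λ {k} pk → ≮⇒≥ (λ k<n → none (k , k<n , pk))

-- What the Helly argument uses of a tree: every edge joins a vertex to its parent, one level up.
record Rooting (T : Graph) : Set where
  open Graph T using (V; Adj)
  field
    depth  : V → ℕ
    parent : V → V

  Up : V → V → Set
  Up a b = parent a ≡ b × depth a ≡ suc (depth b)

  field
    adj-up : ∀ {a b} → Adj a b → Up a b ⊎ Up b a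

module _ {A : Set} {R : Rel A 0ℓ} where

  Linked-∷ʳ : ∀ xs {v w} → Linked R (xs ++ [ v ]) → R v w → Linked R ((xs ++ [ v ]) ++ [ w ])
  Linked-∷ʳ [] [-] r = r ∷ [-]
  Linked-∷ʳ (x ∷ []) (rx ∷ l) r = rx ∷ Linked-∷ʳ [] l r
  Linked-∷ʳ (x ∷ y ∷ xs) (rx ∷ l) r = rx ∷ Linked-∷ʳ (y ∷ xs) l r

module BreadthFirst (T : Graph) (isTree : IsTree T) where
  open Graph T using (V; Adj; adj?; irrefl) renaming (sym to Adj-sym)

  root : V
  root = proj₁ (proj₁ (proj₁ isTree))

  Reach : ℕ → V → Set
  Reach zero u = u ≡ root
  Reach (suc k) u = ∃[ w ] Reach k w × Adj w u

  reach? : ∀ k → Decidable (Reach k)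
  reach? zero u = u ≟ root
  reach? (suc k) u = anyFin? (λ w → reach? k w ×-dec adj? w u)

  reach-along : ∀ {w u} {C : V → Set} k → Reach k w → Star (λ a b → C a × C b × Adj a b) w u → ∃[ j ] Reach j u
  reach-along k reach ε = k , reach
  reach-along k reach ((_ , _ , a) ◅ walk) = reach-along (suc k) (_ , reach , a) walk

  distance : ∀ u → ∃ (IsMinimum (λ k → Reach k u))
  distance u with reach-along 0 refl (proj₂ (proj₁ isTree) {root} {u} _ _)
  ... | k , reach = least (λ j → reach? j u) k reach

  depth : V → ℕ
  depth = proj₁ ∘ distance

  depth-reach : ∀ u → Reach (depth u) u
  depth-reach u = proj₁ (proj₂ (distance u))

  depth-≤ : ∀ u {k} → Reach k u → depth u ≤ k
  depth-≤ u = proj₂ (proj₂ (distance u))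

  depth-adj : ∀ {u w} → Adj u w → depth w ≤ suc (depth u)
  depth-adj {u} {w} a = depth-≤ w (u , depth-reach u , a)

  -- The last vertex before `u` on a shortest walk from the root is reached in one step less, and an
  -- edge raises the depth by at most one.
  predecessor : ∀ u → u ≡ root ⊎ ∃[ w ] Adj w u × depth u ≡ suc (depth w)
  predecessor u = go (depth u) (depth-reach u) refl
    where
    go : ∀ k → Reach k u → depth u ≡ k → u ≡ root ⊎ ∃[ w ] Adj w u × depth u ≡ suc (depth w)
    go zero eq _ = inj₁ eq
    go (suc k) (w , reach , a) eq = inj₂ (w , a ,
      ≤-antisym (depth-adj a) (subst (suc (depth w) ≤_) (sym eq) (s≤s (depth-≤ w reach))))

  depth-root : depth root ≡ 0
  depth-root = n≤0⇒n≡0 (depth-≤ root refl)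

  below-root : ∀ {u w v} → u ≡ root → depth u ≡ depth v → depth v ≢ suc (depth w)
  below-root refl eq eq′ with trans (sym depth-root) (trans eq eq′)
  ... | ()

  -- Otherwise climbing from both ends to their first common ancestor closes a cycle.
  no-bridge : ∀ d {u v} mid → depth u ≡ d → depth v ≡ d → u ≢ v →
              Simple T (u ∷ mid ++ [ v ]) → ¬ All (λ z → d ≤ depth z) (u ∷ mid ++ [ v ])
  no-bridge d {u} {v} mid du dv u≢v (l , uniq) above with predecessor u | predecessor v
  ... | inj₁ u≡r | inj₁ v≡r = u≢v (trans u≡r (sym v≡r))
  ... | inj₁ u≡r | inj₂ (w , _ , eq) = below-root {w = w} u≡r (trans du (sym dv)) eq
  ... | inj₂ (w , _ , eq) | inj₁ v≡r = below-root {w = w} v≡r (trans dv (sym du)) eq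
  no-bridge zero _ du _ _ _ _ | inj₂ (w , _ , eq) | inj₂ _ = 0≢1+n (trans (sym du) eq)
  no-bridge (suc d) {u} {v} mid du dv u≢v (l , uniq) above | inj₂ (w , aw , eqw) | inj₂ (w′ , aw′ , eqw′) = close (w ≟ w′)
    where
    dw : depth w ≡ d
    dw = suc-injective (trans (sym eqw) du)
    dw′ : depth w′ ≡ d
    dw′ = suc-injective (trans (sym eqw′) dv)
    -- The path stays at depth `suc d` or below in the tree, so `w` and `w′` are new to it.
    fresh : ∀ {x} → depth x ≡ d → x ∉ˡ u ∷ mid ++ [ v ]
    fresh dx x∈ = 1+n≰n (subst (suc d ≤_) dx (lookupᴬ above x∈))
    close : Dec (w ≡ w′) → ⊥
    close (yes refl) = proj₂ isTree w u mid v
      (record { nonempty = λ () ; linked = aw ∷ l ; distinct = Unique-∉ (fresh dw) uniq })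
      (Adj-sym aw′)
    close (no w≢w′) = no-bridge d (u ∷ mid ++ [ v ]) dw dw′ w≢w′
      ( aw ∷ Linked-∷ʳ (u ∷ mid) l (Adj-sym aw′)
      , Unique-++⁺ (Unique-∉ (fresh dw) uniq) ([] ∷ [])
          λ { (here eq , here refl) → w≢w′ (sym eq) ; (there z∈ , here refl) → fresh dw′ z∈ } )
      (≤-reflexive (sym dw) ∷ ++⁺ (mapᴬ (≤-trans (n≤1+n d)) above) (≤-reflexive (sym dw′) ∷ []))

  -- The root is made its own parent, a default value; at depth 0 no edge leads up from it.
  parent : V → V
  parent u = [ (λ _ → u) , proj₁ ]′ (predecessor u)

  -- If the chosen predecessor `w` of `b` were not `a`, then `a`, `b`, `w` would be a path joining
  -- two vertices of equal depth with nothing above them, against `no-bridge`.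
  deeper-up : ∀ {a b} → Adj a b → depth a < depth b → parent b ≡ a × depth b ≡ suc (depth a)
  deeper-up {a} {b} ab a<b with predecessor b
  ... | inj₁ refl = contradiction (subst (depth a <_) depth-root a<b) λ ()
  ... | inj₂ (w , wb , eq) with w ≟ a
  ... | yes refl = refl , eq
  ... | no w≢a = ⊥-elim (no-bridge (depth a) (b ∷ []) refl dw (w≢a ∘ sym)
          ( ab ∷ Adj-sym wb ∷ [-]
          , ((λ { refl → <-irrefl refl a<b }) ∷ (w≢a ∘ sym) ∷ [])
            ∷ ((λ { refl → irrefl refl wb }) ∷ []) ∷ [] ∷ [])
          (≤-refl ∷ <⇒≤ a<b ∷ ≤-reflexive (sym dw) ∷ []))
    where
    dw : depth w ≡ depth a
    dw = suc-injective (trans (sym eq) (≤-antisym (depth-adj ab) a<b))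

  rooting : Rooting T
  rooting = record { depth = depth ; parent = parent ; adj-up = adj-up }
    where
    adj-up : ∀ {a b} → Adj a b → (parent a ≡ b × depth a ≡ suc (depth b)) ⊎ (parent b ≡ a × depth b ≡ suc (depth a))
    adj-up {a} {b} ab with <-cmp (depth a) (depth b)
    ... | tri< a<b _ _ = inj₂ (deeper-up ab a<b)
    ... | tri> _ _ b<a = inj₁ (deeper-up (Adj-sym ab) b<a)
    -- An edge within one level is a bridge with empty middle.
    ... | tri≈ _ eq _ = ⊥-elim (no-bridge (depth a) [] refl (sym eq) a≢b
            (ab ∷ [-] , (a≢b ∷ []) ∷ [] ∷ []) (≤-refl ∷ ≤-reflexive eq ∷ []))
      where
      a≢b : a ≢ b
      a≢b a≡b = irrefl a≡b ab

module _ {T : Graph} (R : Rooting T) where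
  open Graph T using (V; Adj; order)
  open Rooting R

  IsTop : Pred V 0ℓ → V → Set
  IsTop C q = C q × (∀ {t} → C t → depth q ≤ depth t)

  -- `C` need not be decidable, so the minimum exists only classically; the inequality proved in the
  -- end is decidable and absorbs the double negation.
  top-exists : ∀ {C t} → C t → ¬ ¬ ∃ (IsTop C)
  top-exists {C} {t} ct none =
    IsMinimum-exists {P = λ k → ∃[ s ] C s × depth s ≡ k} (t , ct , refl)
      λ { (_ , (q , cq , refl) , min) → none (q , cq , λ cs → min (_ , cs , refl)) }

  -- The climb from `t` to `q` along parents inside `C`, in a form that lets two climbs from one
  -- vertex be compared step by step.
  data Chain (C : Pred V 0ℓ) (q : V) : V → Set where
    stop : Chain C q q
    up   : ∀ {t} → C t → depth t ≡ suc (depth (parent t)) → Chain C q (parent t) → Chain C q t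

  -- Along a walk from the top, a step down lengthens the chain and a step up undoes its last step,
  -- as it leads to the parent. No step goes above `q`, by minimality.
  chain : ∀ {C q t} → IsTop C q → ConnectedOn T C → C t → Chain C q t
  chain {C} {q} {t} (cq , min) (_ , walks) ct = go stop (walks cq ct)
    where
    go : ∀ {s s′} → Chain C q s → Star (λ a b → C a × C b × Adj a b) s s′ → Chain C q s′
    go ch ε = ch
    go ch ((ca , cb , ab) ◅ walk) with adj-up ab
    ... | inj₂ (refl , d) = go (up cb d ch) walk
    go stop ((ca , cb , ab) ◅ walk) | inj₁ (_ , d) = contradiction (min cb) (<⇒≱ (≤-reflexive (sym d)))
    go (up _ _ ch) ((ca , cb , ab) ◅ walk) | inj₁ (refl , _) = go ch walk

  Chain-member : ∀ {C q t} → C q → Chain C q t → C t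
  Chain-member cq stop = cq
  Chain-member cq (up ct _ _) = ct

  -- From a common vertex both chains climb through the same parents. The chain to the deeper top
  -- `q` ends no later than the other, which at that moment is still in `C′`.
  lower-top-shared : ∀ {C C′ q q′ s} → IsTop C q → IsTop C′ q′ → depth q′ ≤ depth q →
                     Chain C q s → Chain C′ q′ s → C′ q
  lower-top-shared top (cq′ , _) le stop ch′ = Chain-member cq′ ch′
  lower-top-shared (cq , min) top′ le (up cs d ch) stop =
    contradiction (≤-trans le (min (Chain-member cq ch))) (<⇒≱ (≤-reflexive (sym d)))
  lower-top-shared top top′ le (up cs d ch) (up cs′ d′ ch′) = lower-top-shared top top′ le ch ch′

  depth-bound : ∃[ N ] ∀ t → depth t ≤ N
  depth-bound = max 0 (map depth (allFin order))
              , λ t → lookupᴬ (xs≤max 0 (map depth (allFin order))) (∈-map⁺ depth (∈-allFin t))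

  -- The deepest top of a member lies in all members.
  helly : ∀ {ℓ} {I : Set ℓ} (C : I → Pred V 0ℓ) → I → (∀ i → ConnectedOn T (C i)) →
          (∀ i j → ∃[ t ] C i t × C j t) → ¬ ¬ (∃[ t ] ∀ i → ¬ ¬ C i t)
  helly {I = I} C i₀ conn meet none with depth-bound
  ... | N , bound = top-exists (proj₂ (proj₁ (conn i₀))) λ { (q₀ , top₀) →
      -- Minimising `N ∸ depth q` selects the deepest top.
      IsMinimum-exists {P = λ k → ∃[ i ] ∃[ q ] IsTop (C i) q × N ∸ depth q ≡ k} (i₀ , q₀ , top₀ , refl)
        λ { (_ , (i , q , top , refl) , min) → none (q , λ j ¬cj → top-exists (proj₂ (proj₁ (conn j)))
          λ { (q′ , top′) → ¬cj (shared i j top top′ (∸-cancelʳ-≤ (bound q′) (min (j , q′ , top′ , refl)))) }) } }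
    where
    shared : ∀ i j {q q′} → IsTop (C i) q → IsTop (C j) q′ → depth q′ ≤ depth q → C j q
    shared i j top top′ le with meet i j
    ... | s , ci , cj = lower-top-shared top top′ le (chain top (conn i) ci) (chain top′ (conn j) cj)

-- Traces of connected sets on a tree decomposition

module _ {A : Set} where

  split-unique : ∀ {l : List A} {s} as {bs} as′ {bs′} → Unique l →
                 l ≡ as ++ s ∷ bs → l ≡ as′ ++ s ∷ bs′ → as ≡ as′ × bs ≡ bs′
  split-unique [] [] u refl refl = refl , refl
  split-unique [] (a ∷ as′) (pa ∷ u) refl refl = contradiction refl (lookupᴬ pa (∈-insert as′))
  split-unique (a ∷ as) [] (pa ∷ u) refl refl = contradiction refl (lookupᴬ pa (∈-insert as))
  split-unique (a ∷ as) (_ ∷ as′) (pa ∷ u) refl eq with ∷-injective eq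
  ... | refl , eq′ with split-unique as as′ u refl eq′
  ... | refl , eqb = refl , eqb

  -- `ms` is a stretch of `l` fenced by `e` and `e′`. Since `l` can be cut at a member of `ms` in
  -- one way only, stepping along `l` leaves `ms` only onto a fence.
  module Segment {l : List A} (u : Unique l) as {e} ms {e′ bs} (split : l ≡ as ++ e ∷ ms ++ e′ ∷ bs) where

    split-at : ∀ {s} ms₁ ms₂ → ms ≡ ms₁ ++ s ∷ ms₂ → l ≡ (as ++ e ∷ ms₁) ++ s ∷ (ms₂ ++ e′ ∷ bs)
    split-at {s} ms₁ ms₂ refl = trans split (trans
      (cong (λ m → as ++ e ∷ m) (++-assoc ms₁ (s ∷ ms₂) (e′ ∷ bs)))
      (sym (++-assoc as (e ∷ ms₁) (s ∷ ms₂ ++ e′ ∷ bs))))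

    next-in : ∀ {s s′} → s ∈ˡ ms → Consecutive s s′ l → s′ ∈ˡ ms ⊎ s′ ≡ e′
    next-in {s} {s′} s∈ (cs , ds , eq) with ∈-∃++ s∈
    ... | ms₁ , ms₂ , eqm with split-unique cs (as ++ e ∷ ms₁) u eq (split-at ms₁ ms₂ eqm)
    next-in s∈ (cs , ds , eq) | ms₁ , [] , eqm | _ , refl = inj₂ refl
    next-in s∈ (cs , ds , eq) | ms₁ , m ∷ ms₂ , eqm | _ , refl =
      inj₁ (subst (m ∈ˡ_) (sym eqm) (∈-++⁺ʳ ms₁ (there (here refl))))

    previous-in : ∀ {s s′} → s ∈ˡ ms → Consecutive s′ s l → s′ ∈ˡ ms ⊎ s′ ≡ e
    previous-in {s} {s′} s∈ (cs , ds , eq) with ∈-∃++ s∈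
    ... | ms₁ , ms₂ , eqm with split-unique (cs ∷ʳ s′) (as ++ e ∷ ms₁) u
                                 (trans eq (sym (++-assoc cs [ s′ ] (s ∷ ds)))) (split-at ms₁ ms₂ eqm)
    ... | eqc , _ with initLast ms₁
    ... | [] = inj₂ (∷ʳ-injectiveʳ cs as eqc)
    ... | ms₀ ∷ʳ′ m = inj₁ (subst (_∈ˡ ms) (sym (∷ʳ-injectiveʳ cs (as ++ e ∷ ms₀) (trans eqc (sym (++-assoc as (e ∷ ms₀) [ m ])))))
        (subst (m ∈ˡ_) (sym eqm) (∈-++⁺ˡ {xs = ms₀ ∷ʳ m} (∈-insert ms₀))))

module SubdivisionProperties {H S : Graph} (sub : Subdivision H S) where
  open Graph S using () renaming (V to VS; Adj to AdjS)
  open Graph H using (IsEdge; adj?) renaming (V to VH)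
  open Subdivision sub

  path-unique : ∀ {x y} → IsEdge x y → Unique (path x y)
  path-unique e = IsPath.distinct (path-isPath e)

  path-member : ∀ {x y s} → s ∈ˡ path x y → s ≡ branch x ⊎ s ≡ branch y ⊎ s ∈ˡ interior x y
  path-member (here eq) = inj₁ eq
  path-member {x} {y} (there s∈) with ∈-++⁻ (interior x y) s∈
  ... | inj₁ s∈i = inj₂ (inj₂ s∈i)
  ... | inj₂ (here eq) = inj₂ (inj₁ eq)

  interior⊆path : ∀ {x y s} → s ∈ˡ interior x y → s ∈ˡ path x y
  interior⊆path s∈ = there (∈-++⁺ˡ s∈)

  end∈path : ∀ {x y} → branch y ∈ˡ path x y
  end∈path {x} {y} = there (∈-++⁺ʳ (interior x y) (here refl))

  consecutive-members : ∀ {s s′ : VS} {l} → Consecutive s s′ l → s ∈ˡ l × s′ ∈ˡ l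
  consecutive-members (as , bs , refl) = ∈-++⁺ʳ as (here refl) , ∈-++⁺ʳ as (there (here refl))

  adjacent-on-path : ∀ {s s′} → AdjS s s′ → ∃₂ λ x y → IsEdge x y × s ∈ˡ path x y × s′ ∈ˡ path x y
  adjacent-on-path a with edge-cover a
  ... | x , y , e , inj₁ c = x , y , e , consecutive-members c
  ... | x , y , e , inj₂ c = x , y , e , proj₂ (consecutive-members c) , proj₁ (consecutive-members c)

  -- The path given by `edge-cover` contains `s`, which is no branch vertex and lies in one interior
  -- only; hence it is the path of `xy`.
  interior-consecutive : ∀ {x y s s′} → IsEdge x y → s ∈ˡ interior x y → AdjS s s′ →
                         Consecutive s s′ (path x y) ⊎ Consecutive s′ s (path x y)
  interior-consecutive {x} {y} {s} {s′} e s∈ a with edge-cover a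
  ... | x′ , y′ , e′ , c with path-member {x′} {y′} ([ proj₁ ∘ consecutive-members , proj₂ ∘ consecutive-members ]′ c)
  ... | inj₁ eq = contradiction eq (interior-not-branch e s∈ x′)
  ... | inj₂ (inj₁ eq) = contradiction eq (interior-not-branch e s∈ y′)
  ... | inj₂ (inj₂ s∈′) with interior-disjoint e e′ s∈ s∈′
  ... | refl = c

  module _ {x y} (edge : IsEdge x y) as {e} ms {e′ bs} (split : path x y ≡ as ++ e ∷ ms ++ e′ ∷ bs) where
    open Segment (path-unique edge) as ms split

    -- On the path `s` comes after `e` and before `e′`, whereas `branch x` comes first and
    -- `branch y` last.
    segment⊆interior : ∀ {s} → s ∈ˡ ms → s ∈ˡ interior x y
    segment⊆interior {s} s∈ with ∈-∃++ s∈
    ... | ms₁ , ms₂ , eqm with path-member {x} {y} (subst (s ∈ˡ_) (sym (split-at ms₁ ms₂ eqm)) (∈-insert (as ++ e ∷ ms₁)))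
    ... | inj₂ (inj₂ s∈i) = s∈i
    ... | inj₁ refl with split-unique [] (as ++ e ∷ ms₁) (path-unique edge) refl (split-at ms₁ ms₂ eqm)
    ...   | eq , _ = ⊥-elim (nonempty as eq)
      where
      nonempty : ∀ as → [] ≢ as ++ e ∷ ms₁
      nonempty [] ()
      nonempty (_ ∷ _) ()
    segment⊆interior s∈ | ms₁ , ms₂ , eqm | inj₂ (inj₁ refl)
      with split-unique (branch x ∷ interior x y) (as ++ e ∷ ms₁) (path-unique edge) refl (split-at ms₁ ms₂ eqm)
    ...   | _ , eq = ⊥-elim (nonempty ms₂ eq)
      where
      nonempty : ∀ ms₂ → [] ≢ ms₂ ++ e′ ∷ bs
      nonempty [] ()
      nonempty (_ ∷ _) ()

    -- The neighbours of a vertex of `ms` lie in `ms` or are `e` or `e′`, so a walk inside `C` has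
    -- no way out.
    confined : ∀ {C} → ConnectedOn S C → ¬ C e → ¬ C e′ → ∀ {s t} → s ∈ˡ ms → C s → C t → t ∈ˡ ms
    confined {C} (_ , walks) ¬e ¬e′ s∈ cs ct = go s∈ (walks cs ct)
      where
      go : ∀ {s t} → s ∈ˡ ms → Star (λ a b → C a × C b × AdjS a b) s t → t ∈ˡ ms
      go s∈ ε = s∈
      go s∈ ((ca , cb , ab) ◅ walk) with interior-consecutive edge (segment⊆interior s∈) ab
      ... | inj₁ c = go ([ id , (λ { refl → contradiction cb ¬e′ }) ]′ (next-in s∈ c)) walk
      ... | inj₂ c = go ([ id , (λ { refl → contradiction cb ¬e }) ]′ (previous-in s∈ c)) walk

  confined-to-interior : ∀ {x y C} → IsEdge x y → ConnectedOn S C → ¬ C (branch x) → ¬ C (branch y) →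
                         ∀ {s t} → s ∈ˡ interior x y → C s → C t → t ∈ˡ interior x y
  confined-to-interior {x} {y} edge = confined edge [] (interior x y) refl

  module Trace (D : TreeDecomposition H) where
    open TreeDecomposition D renaming (edge-cover to bag-edge-cover)
    open Graph T using () renaming (V to VT; Adj to AdjT)

    edge-bag : VH → VH → VT
    edge-bag x y with adj? x y
    ... | yes a = proj₁ (bag-edge-cover a)
    -- A default node for non-adjacent pairs.
    ... | no _  = proj₁ (proj₁ (proj₁ T-isTree))

    edge-bag-∋ : ∀ {x y} → IsEdge x y → x ∈ˢ bag (edge-bag x y) × y ∈ˢ bag (edge-bag x y)
    edge-bag-∋ {x} {y} (_ , a) with adj? x y
    ... | yes a′ = proj₂ (bag-edge-cover a′)
    ... | no ¬a  = contradiction a ¬a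

    -- The bags of H as bags of the subdivision, with the interior of each edge xy
    -- put into one bag containing x and y.
    Holds : VT → VS → Set
    Holds t s = (∃[ z ] s ≡ branch z × z ∈ˢ bag t) ⊎
                (∃₂ λ x y → IsEdge x y × s ∈ˡ interior x y × t ≡ edge-bag x y)

    Trace : Pred VS 0ℓ → Pred VT 0ℓ
    Trace C t = ∃[ s ] C s × Holds t s

    held : ∀ s → ∃[ t ] Holds t s
    held s with vertex-cover s
    ... | inj₁ (z , eq) with proj₁ (vertex-connected z)
    ... | t , z∈ = t , inj₁ (z , eq , z∈)
    held s | inj₂ (x , y , e , s∈) = edge-bag x y , inj₂ (x , y , e , s∈ , refl)

    path-held : ∀ {x y s} → IsEdge x y → s ∈ˡ path x y → Holds (edge-bag x y) s
    path-held {x} {y} e s∈ with path-member {x} {y} s∈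
    ... | inj₁ eq = inj₁ (_ , eq , proj₁ (edge-bag-∋ e))
    ... | inj₂ (inj₁ eq) = inj₁ (_ , eq , proj₂ (edge-bag-∋ e))
    ... | inj₂ (inj₂ s∈i) = inj₂ (_ , _ , e , s∈i , refl)

    -- The bags holding one vertex are connected (`around`), and the ends of an edge of the
    -- subdivision share the bag of their edge path; so a walk in `C` lifts to a walk of bags.
    trace-connected : ∀ {C} → ConnectedOn S C → ConnectedOn T (Trace C)
    trace-connected {C} ((s₀ , cs₀) , walks) =
      (proj₁ (held s₀) , s₀ , cs₀ , proj₂ (held s₀)) ,
      λ { (s , cs , h) (s′ , cs′ , h′) → go cs (walks cs cs′) h h′ }
      where
      R : VT → VT → Set
      R a b = Trace C a × Trace C b × AdjT a b

      around : ∀ {s t t′} → C s → Holds t s → Holds t′ s → Star R t t′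
      around cs (inj₁ (z , refl , z∈)) (inj₁ (z′ , eq′ , z∈′)) with branch-injective eq′
      ... | refl = mapStar id (λ { (a , b , ab) → (_ , cs , inj₁ (z , refl , a)) , (_ , cs , inj₁ (z , refl , b)) , ab })
                     (proj₂ (vertex-connected z) z∈ z∈′)
      around cs (inj₁ (z , refl , _)) (inj₂ (x , y , e , s∈ , _)) = contradiction refl (interior-not-branch e s∈ z)
      around cs (inj₂ (x , y , e , s∈ , _)) (inj₁ (z , refl , _)) = contradiction refl (interior-not-branch e s∈ z)
      around cs (inj₂ (x , y , e , s∈ , refl)) (inj₂ (x′ , y′ , e′ , s∈′ , refl)) with interior-disjoint e e′ s∈ s∈′
      ... | refl = ε

      go : ∀ {s s′ t t′} → C s → Star (λ a b → C a × C b × AdjS a b) s s′ →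
           Holds t s → Holds t′ s′ → Star R t t′
      go cs ε h h′ = around cs h h′
      go cs ((_ , cb , ab) ◅ walk) h h′ with adjacent-on-path ab
      ... | x , y , e , s∈ , s∈′ = around cs h (path-held e s∈) ◅◅ go cb walk (path-held e s∈′) h′

-- Shadows of paths in the subdivision

module Shadows {H G : Graph} (rep : H -Graph G) where
  open _-Graph_ rep
  open Graph G using (V; Adj; irrefl)
  open Graph Hᶲ using () renaming (V to VS; Adj to AdjS; sym to AdjS-sym)

  adjacent-meet : ∀ {u v} → Adj u v → ∃[ s ] s ∈ˢ Φ u × s ∈ˢ Φ v
  adjacent-meet {u} {v} a with Equivalence.to (Φ-adjacent λ eq → irrefl eq a) a
  ... | s , s∈ = s , x∈p∩q⁻ (Φ u) (Φ v) s∈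

  Shadow : List V → Pred VS 0ℓ
  Shadow p s = ∃[ v ] v ∈ˡ p × s ∈ˢ Φ v

  -- Every vertex of the shadow is joined to a fixed one in the image of the head: within an image
  -- by its connectedness, and between images of consecutive vertices through a common vertex.
  shadow-connected : ∀ {p} → IsPath G p → ConnectedOn Hᶲ (Shadow p)
  shadow-connected {[]} isPath = contradiction refl (IsPath.nonempty isPath)
  shadow-connected {v ∷ p} isPath with proj₁ (Φ-connected v)
  ... | h , h∈ = (h , v , here refl , h∈) , λ a b → to-head linked a h∈ ◅◅ reverseStar flip (to-head linked b h∈)
    where
    open IsPath isPath
    R : List V → VS → VS → Set
    R p a b = Shadow p a × Shadow p b × AdjS a b

    flip : ∀ {p a b} → R p a b → R p b a
    flip (a , b , ab) = b , a , AdjS-sym ab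

    within : ∀ {v p s h} → s ∈ˢ Φ v → h ∈ˢ Φ v → Star (R (v ∷ p)) s h
    within {v} s∈ h∈ = mapStar id (λ { (a , b , ab) → (v , here refl , a) , (v , here refl , b) , ab })
                         (proj₂ (Φ-connected v) s∈ h∈)

    to-head : ∀ {v p s h} → Linked Adj (v ∷ p) → Shadow (v ∷ p) s → h ∈ˢ Φ v → Star (R (v ∷ p)) s h
    to-head l (_ , here refl , s∈) h∈ = within s∈ h∈
    to-head (a ∷ l) (u , there u∈ , s∈) h∈ with adjacent-meet a
    ... | h′ , h′∈v , h′∈v′ =
      mapStar id (λ { ((c , c∈ , m) , (d , d∈ , n) , ab) → (c , there c∈ , m) , (d , there d∈ , n) , ab })
        (to-head l (u , u∈ , s∈) h′∈v′) ◅◅ within h′∈v h∈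

-- Hitting sets

∣⁅x⁆∪p∣≤1+∣p∣ : ∀ {n} (x : Fin n) (p : Subset n) → ∣ ⁅ x ⁆ ∪ p ∣ ≤ suc ∣ p ∣
∣⁅x⁆∪p∣≤1+∣p∣ zero (inside ∷ p) = s≤s (≤-trans (≤-reflexive (cong ∣_∣ (∪-identityˡ p))) (n≤1+n _))
∣⁅x⁆∪p∣≤1+∣p∣ zero (outside ∷ p) = s≤s (≤-reflexive (cong ∣_∣ (∪-identityˡ p)))
∣⁅x⁆∪p∣≤1+∣p∣ (suc x) (inside ∷ p) = s≤s (∣⁅x⁆∪p∣≤1+∣p∣ x p)
∣⁅x⁆∪p∣≤1+∣p∣ (suc x) (outside ∷ p) = ∣⁅x⁆∪p∣≤1+∣p∣ x p

module _ {n : ℕ} where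

  fromList : List (Fin n) → Subset n
  fromList [] = ∅
  fromList (x ∷ xs) = ⁅ x ⁆ ∪ fromList xs

  ∣fromList∣≤length : ∀ xs → ∣ fromList xs ∣ ≤ length xs
  ∣fromList∣≤length [] = ≤-reflexive (∣⊥∣≡0 n)
  ∣fromList∣≤length (x ∷ xs) = ≤-trans (∣⁅x⁆∪p∣≤1+∣p∣ x (fromList xs)) (s≤s (∣fromList∣≤length xs))

  ∈-fromList : ∀ {x xs} → x ∈ˡ xs → x ∈ˢ fromList xs
  ∈-fromList {xs = x ∷ xs} (here refl) = x∈p∪q⁺ (inj₁ (x∈⁅x⁆ x))
  ∈-fromList (there x∈) = x∈p∪q⁺ (inj₂ (∈-fromList x∈))

elements : ∀ {n} → Subset n → List (Fin n)
elements [] = []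
elements (inside ∷ p) = zero ∷ map suc (elements p)
elements (outside ∷ p) = map suc (elements p)

length-elements : ∀ {n} (p : Subset n) → length (elements p) ≡ ∣ p ∣
length-elements [] = refl
length-elements (inside ∷ p) = cong suc (trans (length-map suc (elements p)) (length-elements p))
length-elements (outside ∷ p) = trans (length-map suc (elements p)) (length-elements p)

∈-elements : ∀ {n} {p : Subset n} {x} → x ∈ˢ p → x ∈ˡ elements p
∈-elements here = here refl
∈-elements {p = inside ∷ p} (there x∈) = there (∈-map⁺ suc (∈-elements x∈))
∈-elements {p = outside ∷ p} (there x∈) = ∈-map⁺ suc (∈-elements x∈)

module _ {A : Set} {P : Pred A 0ℓ} (P? : Decidable P) where

  -- With `takeWhile-all`, this turns containment of a prefix into a comparison of lengths, to which
  -- `argmax` applies.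
  takeWhile-long : ∀ {xs} ys → All P xs → length xs ≤ length (takeWhile P? (xs ++ ys))
  takeWhile-long ys [] = z≤n
  takeWhile-long {x ∷ xs} ys (px ∷ pxs) with P? x
  ... | yes _  = s≤s (takeWhile-long ys pxs)
  ... | no ¬px = contradiction px ¬px

  takeWhile-all : ∀ xs ys → length xs ≤ length (takeWhile P? (xs ++ ys)) → All P xs
  takeWhile-all [] ys le = []
  takeWhile-all (x ∷ xs) ys le with P? x
  takeWhile-all (x ∷ xs) ys (s≤s le) | yes px = px ∷ takeWhile-all xs ys le

  all-or-fails : ∀ xs → All P xs ⊎ ∃[ x ] x ∈ˡ xs × ¬ P x
  all-or-fails xs with all? P? xs
  ... | yes all = inj₁ all
  ... | no ¬all = inj₂ (find (¬All⇒Any¬ P? xs ¬all))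

module _ {A : Set} where

  neighbour-in-list : ∀ {v : A} {p} → v ∈ˡ p → p ≡ [ v ] ⊎ (∃[ u ] u ∈ˡ p × (Consecutive u v p ⊎ Consecutive v u p))
  neighbour-in-list v∈ with ∈-∃++ v∈
  ... | as , u ∷ bs , refl = inj₂ (u , ∈-++⁺ʳ as (there (here refl)) , inj₂ (as , bs , refl))
  ... | as , [] , refl with initLast as
  ...   | [] = inj₁ refl
  ...   | as′ ∷ʳ′ u = inj₂ (u , ∈-++⁺ˡ (∈-insert as′) , inj₁ (as′ , [] , ++-assoc as′ [ u ] _))

  -- Prefixes are tested one entry at a time, `as` being the one rejected so far; `c` ends the first
  -- that satisfies `F`. The tests are classical, as `F` need not be decidable.
  threshold : ∀ (F : Pred (List A) 0ℓ) as bs → ¬ F as → F (as ++ bs) →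
              ¬ ¬ (∃[ cs ] ∃[ c ] ∃[ ds ] as ++ bs ≡ cs ++ c ∷ ds × F (cs ∷ʳ c) × ¬ F cs)
  threshold F as [] ¬fas f none = ¬fas (subst F (++-identityʳ as) f)
  threshold F as (b ∷ bs) ¬fas f none = ¬¬-excluded-middle λ
    { (yes fb) → none (as , b , bs , refl , fb , ¬fas)
    ; (no ¬fb) → threshold F (as ∷ʳ b) bs ¬fb (subst F assoc f)
        λ { (cs , c , ds , eq , rest) → none (cs , c , ds , trans assoc eq , rest) } }
    where
    assoc : as ++ b ∷ bs ≡ (as ∷ʳ b) ++ bs
    assoc = sym (++-assoc as [ b ] bs)

  Unique-++⇒∉ : ∀ (as : List A) {s bs} → Unique (as ++ s ∷ bs) → s ∉ˡ as
  Unique-++⇒∉ (a ∷ as) (pa ∷ u) (here refl) = lookupᴬ pa (∈-insert as) refl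
  Unique-++⇒∉ (a ∷ as) (pa ∷ u) (there s∈) = Unique-++⇒∉ as u s∈

  two-members : ∀ {x y : A} {zs} → x ≢ y → x ∈ˡ zs → y ∈ˡ zs → 2 ≤ length zs
  two-members x≢y (here refl) (here refl) = contradiction refl x≢y
  two-members {zs = _ ∷ _ ∷ _} _ (here _) (there _) = s≤s (s≤s z≤n)
  two-members {zs = _ ∷ _ ∷ _} _ (there _) _ = s≤s (s≤s z≤n)

  reverse-split : ∀ as {s : A} {bs} → reverse (as ++ s ∷ bs) ≡ reverse bs ++ s ∷ reverse as
  reverse-split as {s} {bs} = trans (reverse-++ as (s ∷ bs))
    (trans (cong (_++ reverse as) (unfold-reverse s bs)) (++-assoc (reverse bs) [ s ] (reverse as)))

module Hitting {H G : Graph} (rep : H -Graph G) where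
  open _-Graph_ rep
  open Graph G using (V; Adj; order) renaming (sym to Adj-sym)
  open Graph Hᶲ using () renaming (V to VS)
  open Shadows rep

  share-adjacent : ∀ {u v s} → u ≢ v → s ∈ˢ Φ u → s ∈ˢ Φ v → Adj u v
  share-adjacent u≢v s∈u s∈v = Equivalence.from (Φ-adjacent u≢v) (_ , x∈p∩q⁺ (s∈u , s∈v))

  Hits : List V → List V → Set
  Hits X p = Any (_∈ˡ X) p

  hits? : ∀ X p → Dec (Hits X p)
  hits? X = any? (λ v → mem? _≟_ v X)

  Reaches : List VS → V → VS → Set
  Reaches L v s = ∃₂ λ as bs → L ≡ as ++ s ∷ bs × All (_∈ˢ Φ v) as

  -- For each sequence L choose the vertex x satisfying K whose Φ x contains the
  -- longest prefix of L.  If a longest path contains v satisfying K but none of the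
  -- chosen vertices, then some x is adjacent to v and to a neighbour of v on the
  -- path, and can be inserted between them.
  hitting-set : ∀ (b : VS) {K : Pred V 0ℓ} → Decidable K → (∀ {v} → K v → b ∈ˢ Φ v) →
                ∀ Ls → (∀ {v s} → K v → s ∈ˢ Φ v → ∃[ L ] L ∈ˡ Ls × Reaches L v s) →
                ∃[ X ] length X ≤ length Ls ×
                  (∀ {p v} → IsLongestPath G p → v ∈ˡ p → K v → Hits X p)
  hitting-set b {K} K? K⇒b Ls cover with any? K? (allFin order)
  ... | no none = [] , z≤n , λ {_} {v} _ _ kv → contradiction (loseˡ (∈-allFin v) kv) none
  ... | yes some = map best Ls , ≤-reflexive (length-map best Ls) , hit
    where
    v₀ : V
    v₀ = proj₁ (find some)

    candidates : List V
    candidates = filter K? (allFin order)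

    score : List VS → V → ℕ
    score L v = length (takeWhile (_∈ˢ? Φ v) L)

    best : List VS → V
    best L = argmax (score L) v₀ candidates

    best-K : ∀ L → K (best L)
    best-K L = argmax-all (score L) (proj₂ (proj₂ (find some))) (all-filter K? (allFin order))

    -- The score of `v` is at least the length of the prefix ending in `s`; that of `best L` is no
    -- smaller, so its image contains this prefix too.
    best-reaches : ∀ {L v s} → K v → s ∈ˢ Φ v → Reaches L v s → s ∈ˢ Φ (best L)
    best-reaches {v = v} {s} kv s∈ (as , bs , refl , all) with
      ++⁻ʳ as (takeWhile-all (_∈ˢ? Φ (best L)) (as ∷ʳ s) bs (subst (λ l → length (as ∷ʳ s) ≤ length (takeWhile (_∈ˢ? Φ (best L)) l)) (sym assoc)
        (≤-trans (subst (λ l → length (as ∷ʳ s) ≤ length (takeWhile (_∈ˢ? Φ v) l)) assoc (takeWhile-long (_∈ˢ? Φ v) bs (++⁺ all (s∈ ∷ []))))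
          (lookupᴬ (f[xs]≤f[argmax] v₀ candidates) (∈-filter⁺ K? (∈-allFin v) kv)))))
      where
      L = as ++ s ∷ bs
      assoc : (as ∷ʳ s) ++ bs ≡ L
      assoc = ++-assoc as [ s ] bs
    ... | s∈best ∷ [] = s∈best

    hit : ∀ {p v} → IsLongestPath G p → v ∈ˡ p → K v → Hits (map best Ls) p
    hit {p} {v} longP v∈ kv = decidable-stable (hits? _ p) λ missed →
      let
        fresh : ∀ {L} → L ∈ˡ Ls → best L ∉ˡ p
        fresh L∈ x∈ = missed (loseˡ x∈ (∈-map⁺ best L∈))
        joins : ∀ {L u s} → L ∈ˡ Ls → u ∈ˡ p → s ∈ˢ Φ (best L) → s ∈ˢ Φ u → Adj (best L) u
        joins L∈ u∈ s∈x s∈u = share-adjacent (λ { refl → fresh L∈ u∈ }) s∈x s∈u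
        -- The images of all vertices satisfying `K` share `b`.
        joins-v : ∀ {L} → L ∈ˡ Ls → Adj (best L) v
        joins-v {L} L∈ = joins L∈ v∈ (K⇒b (best-K L)) (K⇒b kv)
        -- A vertex `s` common to the images of `u` and `v` is reached by `v` along some `L`, hence
        -- lies in the image of `best L`.
        joins-neighbour : ∀ {u} → u ∈ˡ p → Adj u v → ∃[ L ] L ∈ˡ Ls × Adj (best L) u
        joins-neighbour u∈ uv =
          let s , s∈u , s∈v = adjacent-meet uv
              L , L∈ , reaches = cover kv s∈v
          in L , L∈ , joins L∈ u∈ (best-reaches kv s∈v reaches) s∈u
      in case-neighbour missed fresh joins-v joins-neighbour (neighbour-in-list v∈)
      where
      case-neighbour : ¬ Hits (map best Ls) p → (∀ {L} → L ∈ˡ Ls → best L ∉ˡ p) →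
        (∀ {L} → L ∈ˡ Ls → Adj (best L) v) →
        (∀ {u} → u ∈ˡ p → Adj u v → ∃[ L ] L ∈ˡ Ls × Adj (best L) u) →
        p ≡ [ v ] ⊎ (∃[ u ] u ∈ˡ p × (Consecutive u v p ⊎ Consecutive v u p)) → ⊥
      -- If the path is `v` alone, any chosen vertex prolongs it; `cover` at `b` provides one.
      case-neighbour missed fresh joins-v joins-u (inj₁ refl) with cover kv (K⇒b kv)
      ... | L , L∈ , _ = <⇒≱ ≤-refl (longest-≥ G longP
            (joins-v L∈ ∷ [-] , Unique-∉ (fresh L∈) ([] ∷ [])))
      case-neighbour missed fresh joins-v joins-u (inj₂ (u , u∈ , inj₁ c@(as , bs , refl)))
        with joins-u u∈ (Linked-consecutive as (IsPath.linked (proj₁ longP)))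
      ... | L , L∈ , xu = longest-no-insertion G longP c (fresh L∈) (Adj-sym xu) (joins-v L∈)
      case-neighbour missed fresh joins-v joins-u (inj₂ (u , u∈ , inj₂ c@(as , bs , refl)))
        with joins-u u∈ (Adj-sym (Linked-consecutive as (IsPath.linked (proj₁ longP))))
      ... | L , L∈ , xu = longest-no-insertion G longP c (fresh L∈) (Adj-sym (joins-v L∈)) xu

  open SubdivisionProperties subdivision
  open Subdivision subdivision
  open Graph H using (IsEdge; edges; ∣E∣) renaming (Adj to AdjH; order to orderH; adj? to adjH?; sym to AdjH-sym)

  ∈-edges : ∀ {x y} → IsEdge x y → (x , y) ∈ˡ edges
  ∈-edges {x} {y} e = ∈-filter⁺ (λ (x , y) → (x <ᶠ? y) ×-dec adjH? x y)
                        (∈-cartesianProduct⁺ (∈-allFin x) (∈-allFin y)) e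

  -- Both directions occur because an image may meet an edge path in an initial and in a final
  -- segment.
  directed-paths : List (List VS)
  directed-paths = map (λ (x , y) → path x y) edges ++ map (λ (x , y) → reverse (path x y)) edges

  length-directed-paths : length directed-paths ≡ ∣E∣ + ∣E∣
  length-directed-paths = trans (length-++ (map _ edges)) (cong₂ _+_ (length-map _ edges) (length-map _ edges))

  module _ (2≤H : 2 ≤ orderH) (connH : Connected H) where

    -- A walk from `z` to a second vertex of `H` begins with an edge at `z`; `orient` puts its
    -- smaller end first, as `IsEdge` requires.
    incident-edge : ∀ z → ∃₂ λ x y → IsEdge x y × branch z ∈ˡ path x y
    incident-edge z = orient (neighbour (another z 2≤H))
      where
      another : ∀ {n} (z : Fin n) → 2 ≤ n → ∃[ w ] z ≢ w
      another {suc zero} _ (s≤s ())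
      another {suc (suc n)} zero _ = suc zero , λ ()
      another {suc (suc n)} (suc z) _ = zero , λ ()
      neighbour : ∃[ w ] z ≢ w → ∃ (AdjH z)
      neighbour (w , z≢w) with proj₂ connH {z} {w} _ _
      ... | ε = contradiction refl z≢w
      ... | (_ , _ , a) ◅ _ = _ , a
      orient : ∃ (AdjH z) → ∃₂ λ x y → IsEdge x y × branch z ∈ˡ path x y
      orient (w , a) with <ᶠ-cmp z w
      ... | tri< z<w _ _ = z , w , (z<w , a) , here refl
      ... | tri≈ _ eq _ = contradiction a (Graph.irrefl H eq)
      ... | tri> _ _ w<z = w , z , (w<z , AdjH-sym a) , end∈path {w} {z}

    on-path : ∀ s → ∃₂ λ x y → IsEdge x y × s ∈ˡ path x y
    on-path s with vertex-cover s
    ... | inj₁ (z , refl) = incident-edge z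
    ... | inj₂ (x , y , e , s∈) = x , y , e , interior⊆path s∈

    branch-hitting-set : ∀ z → ∃[ X ] length X ≤ ∣E∣ + ∣E∣ ×
      (∀ {p} → IsLongestPath G p → Shadow p (branch z) → Hits X p)
    branch-hitting-set z with hitting-set (branch z) (λ v → branch z ∈ˢ? Φ v) id directed-paths cover
      where
      cover : ∀ {v s} → branch z ∈ˢ Φ v → s ∈ˢ Φ v → ∃[ L ] L ∈ˡ directed-paths × Reaches L v s
      cover {v} {s} z∈ s∈ with on-path s
      ... | x , y , e , s∈p with ∈-∃++ s∈p
      ... | as , bs , eq with all-or-fails (_∈ˢ? Φ v) as | all-or-fails (_∈ˢ? Φ v) bs
      ... | inj₁ all | _ = path x y , ∈-++⁺ˡ (∈-map⁺ _ (∈-edges e)) , as , bs , eq , all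
      ... | inj₂ _ | inj₁ all = reverse (path x y) , ∈-++⁺ʳ (map _ edges) (∈-map⁺ _ (∈-edges e)) , reverse bs , reverse as
              , trans (cong reverse eq) (reverse-split as) , tabulateᴬ (λ z∈ → lookupᴬ all (reverse⁻ z∈))
      -- Missing `f` before `s` and `g` after it, `Φ v` would be confined to interior vertices
      -- between them, yet it contains `branch z`.
      ... | inj₂ (f , f∈ , ¬f) | inj₂ (g , g∈ , ¬g) with ∈-∃++ f∈ | ∈-∃++ g∈
      ... | as₁ , as₂ , refl | bs₁ , bs₂ , refl =
        contradiction refl (interior-not-branch e (segment⊆interior e as₁ (as₂ ++ s ∷ bs₁) split
          (confined e as₁ (as₂ ++ s ∷ bs₁) split (Φ-connected v) ¬f ¬g (∈-insert as₂) s∈ z∈)) z)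
        where
        split : path x y ≡ as₁ ++ f ∷ (as₂ ++ s ∷ bs₁) ++ g ∷ bs₂
        split = trans eq (trans (++-assoc as₁ (f ∷ as₂) (s ∷ bs₁ ++ g ∷ bs₂))
                  (cong (λ l → as₁ ++ f ∷ l) (sym (++-assoc as₂ (s ∷ bs₁) (g ∷ bs₂)))))
    ... | X , size , hits = X , ≤-trans size (≤-reflexive length-directed-paths) , λ longP (v , v∈ , z∈) → hits longP v∈ z∈

  path-around : ∀ {x y} cs {c ds} → interior x y ≡ cs ++ c ∷ ds →
                path x y ≡ branch x ∷ cs ++ c ∷ ds ∷ʳ branch y
  path-around {x} {y} cs {c} {ds} eq =
    cong (branch x ∷_) (trans (cong (_∷ʳ branch y) eq) (++-assoc cs (c ∷ ds) [ branch y ]))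

  -- An image that contains `c` and avoids both ends stays in the interior of `xy`, so two sequences
  -- suffice: those running from `c` towards either end.
  interior-hitting-set : ∀ {x y} → IsEdge x y → ∀ cs c ds → interior x y ≡ cs ++ c ∷ ds →
    ∃[ X ] length X ≤ 2 × (∀ {p} → IsLongestPath G p → ¬ Shadow p (branch x) →
      ¬ Shadow p (branch y) → Shadow p c → Hits X p)
  interior-hitting-set {x} {y} e cs c ds eq
    with hitting-set c K? proj₁ Ls cover
    where
    K : Pred V 0ℓ
    K v = c ∈ˢ Φ v × branch x ∉ˢ Φ v × branch y ∉ˢ Φ v
    K? : Decidable K
    K? v = (c ∈ˢ? Φ v) ×-dec (¬? (branch x ∈ˢ? Φ v) ×-dec ¬? (branch y ∈ˢ? Φ v))
    Ls : List (List VS)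
    Ls = (c ∷ ds) ∷ reverse (cs ∷ʳ c) ∷ []
    interior-unique : Unique (cs ++ c ∷ ds)
    interior-unique = subst Unique eq (Unique-++⁻ˡ (interior x y) (Unique-++⁻ʳ [ branch x ] (path-unique e)))
    path-split : path x y ≡ branch x ∷ cs ++ c ∷ ds ∷ʳ branch y
    path-split = path-around cs eq

    cover : ∀ {v s} → K v → s ∈ˢ Φ v → ∃[ L ] L ∈ˡ Ls × Reaches L v s
    cover {v} {s} (c∈ , x∉ , y∉) s∈ = located (∈-++⁻ cs (subst (s ∈ˡ_) eq
        (confined-to-interior e (Φ-connected v) x∉ y∉ (subst (c ∈ˡ_) (sym eq) (∈-insert cs)) c∈ s∈)))
      where
      located : s ∈ˡ cs ⊎ s ∈ˡ c ∷ ds → ∃[ L ] L ∈ˡ Ls × Reaches L v s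
      located (inj₂ (here refl)) = c ∷ ds , here refl , [] , ds , refl , []
      located (inj₂ (there s∈ds)) with ∈-∃++ s∈ds
      ... | es , fs , refl with all-or-fails (_∈ˢ? Φ v) es
      ...   | inj₁ all = c ∷ ds , here refl , c ∷ es , fs , refl , c∈ ∷ all
      -- Missing `f` between `c` and `s`, `Φ v` would be confined to the stretch beyond `f`, so `c`
      -- would occur twice. The other side of `c` is symmetric.
      ...   | inj₂ (f , f∈ , ¬f) with ∈-∃++ f∈
      ...     | es₁ , es₂ , refl = contradiction
        (subst (c ∈ˡ_) (sym (++-assoc es₁ (f ∷ es₂) (s ∷ fs))) (∈-++⁺ʳ es₁ (there
          (confined e (branch x ∷ cs ++ c ∷ es₁) (es₂ ++ s ∷ fs) split (Φ-connected v) ¬f y∉ (∈-insert es₂) s∈ c∈))))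
        (Unique[x∷xs]⇒x∉xs (Unique-++⁻ʳ cs interior-unique))
        where
        split : path x y ≡ (branch x ∷ cs ++ c ∷ es₁) ++ f ∷ (es₂ ++ s ∷ fs) ++ branch y ∷ []
        split = trans path-split (trans
          (cong (λ l → branch x ∷ cs ++ c ∷ l) (trans (cong (_∷ʳ branch y) (++-assoc es₁ (f ∷ es₂) (s ∷ fs)))
                                                      (++-assoc es₁ (f ∷ es₂ ++ s ∷ fs) [ branch y ])))
          (sym (++-assoc (branch x ∷ cs) (c ∷ es₁) (f ∷ (es₂ ++ s ∷ fs) ∷ʳ branch y))))
      located (inj₁ s∈cs) with ∈-∃++ s∈cs
      ... | es , fs , refl with all-or-fails (_∈ˢ? Φ v) fs
      ...   | inj₁ all = reverse (cs ∷ʳ c) , there (here refl) , reverse (fs ∷ʳ c) , reverse es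
              , trans (cong reverse (++-assoc es (s ∷ fs) [ c ])) (reverse-split es)
              , tabulateᴬ (λ z∈ → lookupᴬ (++⁺ all (c∈ ∷ [])) (reverse⁻ {xs = fs ∷ʳ c} z∈))
      ...   | inj₂ (f , f∈ , ¬f) with ∈-∃++ f∈
      ...     | fs₁ , fs₂ , refl = contradiction
        (subst (c ∈ˡ_) (++-assoc es (s ∷ fs₁) (f ∷ fs₂)) (∈-++⁺ˡ
          (confined e [] (es ++ s ∷ fs₁) split (Φ-connected v) x∉ ¬f (∈-insert es) s∈ c∈)))
        (Unique-++⇒∉ cs interior-unique)
        where
        split : path x y ≡ branch x ∷ (es ++ s ∷ fs₁) ++ f ∷ (fs₂ ++ c ∷ ds ∷ʳ branch y)
        split = trans path-split (cong (branch x ∷_) (trans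
          (cong (_++ c ∷ ds ∷ʳ branch y) (sym (++-assoc es (s ∷ fs₁) (f ∷ fs₂))))
          (++-assoc (es ++ s ∷ fs₁) (f ∷ fs₂) (c ∷ ds ∷ʳ branch y))))
  ... | X , size , hits = X , size , λ longP ¬x ¬y (v , v∈ , c∈) →
    hits longP v∈ (c∈ , (λ x∈ → ¬x (v , v∈ , x∈)) , (λ y∈ → ¬y (v , v∈ , y∈)))

-- The longest path transversal

bag-size : ∀ {H} (D : TreeDecomposition H) t → let open TreeDecomposition D in ∣ bag t ∣ ≤ width + 1
bag-size D t = begin
  ∣ bag t ∣                  ≤⟨ lookupᴬ (xs≤max 0 sizes) (∈-map⁺ (∣_∣ ∘ bag) (∈-allFin t)) ⟩
  -- This also holds when the subtraction in `width` is truncated.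
  max 0 sizes                ≤⟨ m≤n+m∸n _ 1 ⟩
  1 + width                  ≡⟨ +-comm 1 width ⟩
  width + 1                  ∎
  where
  open ≤-Reasoning
  open TreeDecomposition D
  sizes : List ℕ
  sizes = map (∣_∣ ∘ bag) (allFin (Graph.order T))

module Transversal {H G : Graph} (2≤H : 2 ≤ Graph.order H) (connH : Connected H) (connG : Connected G)
                   (rep : H -Graph G) (D : TreeDecomposition H) where
  open _-Graph_ rep
  open Graph G using (V)
  open Graph H using (IsEdge; ∣E∣; irrefl)
  open Graph Hᶲ using () renaming (V to VS)
  open Subdivision subdivision
  open SubdivisionProperties subdivision
  open Shadows rep
  open Hitting rep
  open TreeDecomposition D using (T; T-isTree; bag; width)
  open Trace D

  bound : ℕ
  bound = 4 * (width + 1) * ∣E∣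

  branches-hitting-set : ∀ zs → ∃[ X ] length X ≤ length zs * (∣E∣ + ∣E∣) ×
    (∀ {p z} → IsLongestPath G p → z ∈ˡ zs → Shadow p (branch z) → Hits X p)
  branches-hitting-set [] = [] , z≤n , λ _ ()
  branches-hitting-set (z ∷ zs) with branch-hitting-set 2≤H connH z | branches-hitting-set zs
  ... | X , size , hits | Y , sizes , hitss = X ++ Y
    , ≤-trans (≤-reflexive (length-++ X)) (+-mono-≤ size sizes)
    , λ { longP (here refl) sh → mapᴱ ∈-++⁺ˡ (hits longP sh)
        ; longP (there z∈) sh → mapᴱ (∈-++⁺ʳ X) (hitss longP z∈ sh) }

  shadows-meet : ∀ {p q} → IsLongestPath G p → IsLongestPath G q → ∃[ s ] Shadow p s × Shadow q s
  shadows-meet longP longQ with longest-paths-meet G connG longP longQ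
  ... | v , v∈p , v∈q with proj₁ (Φ-connected v)
  ... | s , s∈ = s , (v , v∈p , s∈) , (v , v∈q , s∈)

  common-bag : ∃ (IsLongestPath G) → ¬ ¬ (∃[ t ] ∀ {p} → IsLongestPath G p → ¬ ¬ Trace (Shadow p) t)
  common-bag i₀ none = helly (BreadthFirst.rooting T T-isTree) {I = ∃ (IsLongestPath G)} (λ (p , _) → Trace (Shadow p)) i₀
    (λ (p , longP) → trace-connected (shadow-connected (proj₁ longP)))
    (λ (p , longP) (q , longQ) → let s , sp , sq = shadows-meet longP longQ
                                     t , h = held s in t , (s , sp , h) , (s , sq , h))
    λ { (t , all) → none (t , λ longP → all (_ , longP)) }

  -- Hitting is doubly negated because it rests on classical case distinctions; `hits?` removes the
  -- negations at the end.
  Transversal : Set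
  Transversal = ∃[ X ] length X ≤ bound × (∀ {p} → IsLongestPath G p → ¬ ¬ Hits X p)

  branch-transversal : ∀ t → (∀ {p} → IsLongestPath G p → ¬ ¬ (∃[ z ] z ∈ˢ bag t × Shadow p (branch z))) →
                       Transversal
  branch-transversal t all with branches-hitting-set (elements (bag t))
  ... | X , size , hits = X , small , λ longP ¬hit → all longP λ (z , z∈ , sh) → ¬hit (hits longP (∈-elements z∈) sh)
    where
    open ≤-Reasoning
    arith : ∀ w m → w * (m + m) + w * (m + m) ≡ 4 * w * m
    arith = solve-∀
    small : length X ≤ bound
    small = begin
      length X                                ≤⟨ size ⟩
      length (elements (bag t)) * (∣E∣ + ∣E∣)  ≡⟨ cong (_* (∣E∣ + ∣E∣)) (length-elements (bag t)) ⟩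
      ∣ bag t ∣ * (∣E∣ + ∣E∣)                  ≤⟨ *-monoˡ-≤ (∣E∣ + ∣E∣) (bag-size D t) ⟩
      (width + 1) * (∣E∣ + ∣E∣)                ≤⟨ m≤m+n _ _ ⟩
      (width + 1) * (∣E∣ + ∣E∣) + (width + 1) * (∣E∣ + ∣E∣) ≡⟨ arith (width + 1) ∣E∣ ⟩
      bound                                   ∎

  module _ {x y} (e : IsEdge x y) {p₀} (long₀ : IsLongestPath G p₀)
           (¬x₀ : ¬ Shadow p₀ (branch x)) (¬y₀ : ¬ Shadow p₀ (branch y))
           {s₀} (s₀∈ : s₀ ∈ˡ interior x y) (sh₀ : Shadow p₀ s₀) where

    AvoidsEnds : List V → Set
    AvoidsEnds p = ¬ Shadow p (branch x) × ¬ Shadow p (branch y)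

    -- The shadow of `p₀` is confined to the interior of `xy`. That of `p` meets it, so it has a
    -- vertex there and is confined as well.
    shadow⊆interior : ∀ {p s} → IsLongestPath G p → AvoidsEnds p → Shadow p s → s ∈ˡ interior x y
    shadow⊆interior longP (¬x , ¬y) sh with shadows-meet long₀ longP
    ... | s , sh₀′ , sh′ = confined-to-interior e (shadow-connected (proj₁ longP)) ¬x ¬y
      (confined-to-interior e (shadow-connected (proj₁ long₀)) ¬x₀ ¬y₀ s₀∈ sh₀ sh₀′) sh′ sh

    FitsIn : Pred (List VS) 0ℓ
    FitsIn l = ∃[ p ] IsLongestPath G p × AvoidsEnds p × (∀ {s} → Shadow p s → s ∈ˡ l)

    -- c is the last vertex of the shortest initial piece of the interior of xy
    -- containing a shadow; every other shadow within the interior meets that piece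
    -- but does not fit before c.
    interior-cut : ¬ ¬ (∃[ cs ] ∃[ c ] ∃[ ds ] interior x y ≡ cs ++ c ∷ ds ×
                     (∀ {p} → IsLongestPath G p → AvoidsEnds p → ¬ ¬ Shadow p c))
    interior-cut none = threshold FitsIn [] (interior x y)
      (λ (p , longP , _ , ⊆[]) → case-empty (⊆[] (proj₂ (proj₁ (shadow-connected (proj₁ longP))))))
      (p₀ , long₀ , (¬x₀ , ¬y₀) , shadow⊆interior long₀ (¬x₀ , ¬y₀))
      λ (cs , c , ds , eq , (p₁ , long₁ , _ , ⊆₁) , ¬fits) → none (cs , c , ds , eq ,
        λ {p} longP avoids ¬c → let s , sh₁ , sh = shadows-meet long₁ longP in
          -- Missing `c`, the shadow of `p` would be confined between `branch x` and `c`, that is,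
          -- to `cs`.
          ¬fits (p , longP , avoids ,
            confined e [] cs (path-around cs eq) (shadow-connected (proj₁ longP)) (proj₁ avoids) ¬c
              (before ¬c sh (∈-++⁻ cs (⊆₁ sh₁))) sh))
      where
      case-empty : ∀ {s : VS} → s ∉ˡ []
      case-empty ()
      before : ∀ {p cs c s} → ¬ Shadow p c → Shadow p s → s ∈ˡ cs ⊎ s ∈ˡ [ c ] → s ∈ˡ cs
      before ¬c sh (inj₁ s∈) = s∈
      before ¬c sh (inj₂ (here refl)) = contradiction sh ¬c

    edge-transversal : 2 ≤ width + 1 → ¬ ¬ Transversal
    edge-transversal 2≤w none = interior-cut λ (cs , c , ds , eq , all) →
      let X , sizeX , hitsX = branch-hitting-set 2≤H connH x
          Y , sizeY , hitsY = branch-hitting-set 2≤H connH y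
          Z , sizeZ , hitsZ = interior-hitting-set e cs c ds eq
          XYZ = X ++ Y ++ Z
      in none (XYZ
        , small (≤-trans (≤-reflexive (trans (length-++ X) (cong (length X +_) (length-++ Y))))
                         (+-mono-≤ sizeX (+-mono-≤ sizeY sizeZ)))
        , λ longP ¬hit →
            let ¬x = λ sh → ¬hit (mapᴱ ∈-++⁺ˡ (hitsX longP sh))
                ¬y = λ sh → ¬hit (mapᴱ (∈-++⁺ʳ X ∘ ∈-++⁺ˡ) (hitsY longP sh))
            in all longP (¬x , ¬y) λ sh → ¬hit (mapᴱ (∈-++⁺ʳ X ∘ ∈-++⁺ʳ Y) (hitsZ longP ¬x ¬y sh)))
      where
      open ≤-Reasoning
      small : ∀ {k} → k ≤ (∣E∣ + ∣E∣) + ((∣E∣ + ∣E∣) + 2) → k ≤ bound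
      small {k} le = begin
        k                                     ≤⟨ le ⟩
        -- As `xy` is an edge, the 2 is at most twice `∣E∣`; the total of six times `∣E∣` is then
        -- rounded up to eight.
        (∣E∣ + ∣E∣) + ((∣E∣ + ∣E∣) + 2)         ≤⟨ +-monoʳ-≤ (∣E∣ + ∣E∣) (+-monoʳ-≤ (∣E∣ + ∣E∣)
                                                    (+-mono-≤ 1≤E 1≤E)) ⟩
        (∣E∣ + ∣E∣) + ((∣E∣ + ∣E∣) + (∣E∣ + ∣E∣)) ≤⟨ m≤m+n _ (∣E∣ + ∣E∣) ⟩
        (∣E∣ + ∣E∣) + ((∣E∣ + ∣E∣) + (∣E∣ + ∣E∣)) + (∣E∣ + ∣E∣) ≡⟨ arith ∣E∣ ⟩
        4 * 2 * ∣E∣                            ≤⟨ *-monoˡ-≤ ∣E∣ (*-monoʳ-≤ 4 2≤w) ⟩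
        bound                                 ∎
        where
        1≤E : 1 ≤ ∣E∣
        1≤E = ∈-length (∈-edges e)
        arith : ∀ m → (m + m) + ((m + m) + (m + m)) + (m + m) ≡ 4 * 2 * m
        arith = solve-∀

  transversal : ¬ ¬ Transversal
  transversal none = ¬¬-excluded-middle λ
    { (no ¬long) → none ([] , z≤n , λ longP → contradiction (_ , longP) ¬long)
    ; (yes i₀) → common-bag i₀ λ (t , all) →
        -- Either every longest path meets a branch vertex of `bag t`, or some `p` avoids them all;
        -- the trace of `p` then contains `t` because of the interior of an edge whose bag is `t`.
        ¬¬-excluded-middle {A = ∃[ p ] IsLongestPath G p × ¬ (∃[ z ] z ∈ˢ bag t × Shadow p (branch z))} λ
        { (no ¬avoiding) → none (branch-transversal t λ longP ¬branch → ¬avoiding (_ , longP , ¬branch))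
        ; (yes (p , longP , avoids)) → all longP (traced t p longP avoids) } }
    where
    traced : ∀ t p → IsLongestPath G p → ¬ (∃[ z ] z ∈ˢ bag t × Shadow p (branch z)) → ¬ Trace (Shadow p) t
    traced t p longP avoids (s , sh , inj₁ (z , refl , z∈)) = avoids (z , z∈ , sh)
    traced t p longP avoids (s , sh , inj₂ (x , y , e , s∈ , refl)) =
      edge-transversal e longP (λ sh → avoids (x , x∈ , sh)) (λ sh → avoids (y , y∈ , sh)) s∈ sh
        -- `x` and `y` are distinct members of `bag t`, which gives `2 ≤ width + 1`.
        (≤-trans (two-members (λ eq → irrefl eq (proj₂ e)) (∈-elements x∈) (∈-elements y∈))
          (≤-trans (≤-reflexive (length-elements (bag t))) (bag-size D t)))
        none
      where
      x∈ = proj₁ (edge-bag-∋ e)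
      y∈ = proj₂ (edge-bag-∋ e)

theorem4p2 : ∀ (H : Graph) → 2 ≤ Graph.order H → Connected H →
    ∀ (G : Graph) → Connected G → H -Graph G →
    ∀ (tw lpt : ℕ) → Treewidth H tw → Lpt G lpt →
    lpt ≤ 4 * (tw + 1) * Graph.∣E∣ H
theorem4p2 H 2≤H connH G connG rep tw lpt ((D , refl) , _) (_ , lpt-min) =
  -- The inequality is decidable, so a transversal up to double negation is enough.
  decidable-stable (lpt ≤? _) λ larger → transversal λ (X , small , hits) →
    larger (≤-trans
      (lpt-min (fromList X , (λ p longP → mapᴱ ∈-fromList (decidable-stable (hits? X p) (hits longP))) , refl))
      (≤-trans (∣fromList∣≤length X) small))
  where
  open Transversal 2≤H connH connG rep D
  open Hitting rep using (hits?)
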